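{- Let $G=(V,E)$ be a connected graph with chromatic number $2$, let $\emptyset\ne V_c\subsetneq V$, and let $g:V_c\to\{0,1\}$ be such that no two adjacent vertices of $V_c$ have the same value under $g$. Let $\phi_0,\phi_1:V\to\{0,1\}$ be the two proper $2$-colourings of $G$, and for $i=0,1$ let $V_{\phi_i}=\{v\in V_c : g(v)=\phi_i(v)\}$. Suppose $|V_{\phi_0}|=1$ or $|V_{\phi_1}|=1$. If $f$ is a maximum contrast greyscale for the $\{0,1\}$-restricted maximum contrast problem on $G$ with initial colouring $g$, then $\mathrm{Im}(f)\subseteq\{0,\frac12,1\}$.
   Context: Graphs are finite, undirected and simple. A greyscale of $G=(V,E)$ is a map $f:V\to[0,1]$ with $0,1\in \mathrm{Im}(f)$. For $e=\{u,v\}\in E$ put $\widehat f(e)=|f(u)-f(v)|$. The contrast vector $\mathcal C_f$ is the vector of all values $\widehat f(e)$, $e\in E$, listed in ascending order; contrast vectors are compared lexicographically. A greyscale $f$ is compatible with $g$ if $f(u)=g(u)$ for all $u\in V_c$. A maximum contrast greyscale for the $\{0,1\}$-restricted maximum contrast problem ($\{0,1\}$-RMACG) with data $(G,V_c,g)$ is a greyscale compatible with $g$ whose contrast vector is the lexicographic maximum among all greyscales of $G$ compatible with $g$. -}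

module Defs where

import Level
open import Level using (Level; 0ℓ; _⊔_)
open import Algebra.Bundles using (CommutativeRing)
open import Algebra.Structures using (IsCommutativeRing)
open import Algebra.Core using (Op₁; Op₂)
import Algebra.Construct.NaturalChoice.Max as Max
open import Data.Nat.Base as ℕ using (ℕ)
open import Data.Fin.Base using (Fin; zero; suc; _<_)
open import Data.Fin.Properties using (_<?_; _≟_)
open import Data.Fin.Subset using (Subset; Side; outside; _∈_)
open import Data.Fin.Subset.Properties using (_∈?_)
open import Data.List.Base using (List; map; filter; cartesianProduct; allFin)
import Data.List.Sort as Sort
open import Data.List.Relation.Binary.Lex.NonStrict using (Lex-≤)
open import Data.Product.Base using (_×_; _,_; ∃; ∃-syntax)
open import Data.Vec.Base using (tabulate)
open import Relation.Binary.Bundles using (DecTotalOrder)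
open import Relation.Binary.Core using (Rel)
open import Relation.Binary.Definitions using (Decidable; Symmetric)
open import Relation.Binary.Structures using (IsDecTotalOrder)
open import Relation.Binary.Construct.Closure.ReflexiveTransitive using (Star)
open import Relation.Binary.PropositionalEquality using (_≡_; _≢_)
open import Relation.Nullary using (¬_; Dec; yes; no; does)
open import Relation.Nullary.Decidable using (_×-dec_)
open import Relation.Unary using (Pred)

-- The real numbers, given by their categorical axiomatisation as a
-- Dedekind-complete ordered field.  The order is decidable, as it is
-- classically.

record RealField (c ℓ₁ ℓ₂ : Level) : Set (Level.suc (c ⊔ ℓ₁ ⊔ ℓ₂)) where
  infix  4 _≈_ _≤_
  infixl 6 _+_
  infixl 7 _*_
  infix  8 -_
  infix  9 _⁻¹
  field
    Carrier           : Set c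
    _≈_               : Rel Carrier ℓ₁
    _≤_               : Rel Carrier ℓ₂
    _+_ _*_           : Op₂ Carrier
    -_                : Op₁ Carrier
    0# 1#             : Carrier
    -- Total, but unspecified at 0#.
    _⁻¹               : Op₁ Carrier
    isCommutativeRing : IsCommutativeRing _≈_ _+_ _*_ -_ 0# 1#
    0≉1               : ¬ (0# ≈ 1#)
    *-inverse         : ∀ x → ¬ (x ≈ 0#) → (x * x ⁻¹) ≈ 1#
    isDecTotalOrder   : IsDecTotalOrder _≈_ _≤_
    +-monoˡ-≤         : ∀ z {x y} → x ≤ y → (x + z) ≤ (y + z)
    *-nonNegative     : ∀ {x y} → 0# ≤ x → 0# ≤ y → 0# ≤ (x * y)

  UpperBound : Pred Carrier (c ⊔ ℓ₁ ⊔ ℓ₂) → Pred Carrier (c ⊔ ℓ₁ ⊔ ℓ₂)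
  UpperBound P b = ∀ x → P x → x ≤ b

  field
    complete : (P : Pred Carrier (c ⊔ ℓ₁ ⊔ ℓ₂)) → ∃ P → ∃ (UpperBound P) →
               ∃[ s ] (UpperBound P s × (∀ b → UpperBound P b → s ≤ b))

  commutativeRing : CommutativeRing c ℓ₁
  commutativeRing = record { isCommutativeRing = isCommutativeRing }

  decTotalOrder : DecTotalOrder c ℓ₁ ℓ₂
  decTotalOrder = record { isDecTotalOrder = isDecTotalOrder }

  open Max (DecTotalOrder.totalOrder decTotalOrder) public
    using () renaming (_⊔_ to max)

  ∣_∣ : Op₁ Carrier
  ∣ x ∣ = max x (- x)

  ½ : Carrier
  ½ = (1# + 1#) ⁻¹

record Graph : Set₁ where
  infix 4 _~_ _~?_
  field
    order    : ℕ
  Vertex : Set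
  Vertex = Fin order
  field
    _~_      : Rel Vertex 0ℓ
    _~?_     : Decidable _~_
    ~-sym    : Symmetric _~_
    ~-irrefl : ∀ v → ¬ (v ~ v)

  -- Each edge {u , v} is listed once, as the pair with u < v.
  edges : List (Vertex × Vertex)
  edges = filter (λ (u , v) → (u <? v) ×-dec (u ~? v))
                 (cartesianProduct (allFin order) (allFin order))

  Connected : Set
  Connected = ∀ u v → Star _~_ u v

  ProperColouring : ∀ {k} → (Vertex → Fin k) → Set
  ProperColouring φ = ∀ {u v} → u ~ v → φ u ≢ φ v

  Colourable : ℕ → Set
  Colourable k = ∃[ φ ] ProperColouring {k} φ

  ChromaticNumber : ℕ → Set
  ChromaticNumber k = Colourable k × (∀ j → Colourable j → k ℕ.≤ j)

  InitialColouring : Subset order → Set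
  InitialColouring Vc = ∀ v → v ∈ Vc → Fin 2

  ProperInitialColouring : (Vc : Subset order) → InitialColouring Vc → Set
  ProperInitialColouring Vc g =
    ∀ {u v} (u∈ : u ∈ Vc) (v∈ : v ∈ Vc) → u ~ v → g u u∈ ≢ g v v∈

  -- { v ∈ Vc ∣ g v ≡ φ v }
  agreement : (Vc : Subset order) → InitialColouring Vc →
              (Vertex → Fin 2) → Subset order
  agreement Vc g φ = tabulate (λ v → side v (v ∈? Vc))
    where
    side : ∀ v → Dec (v ∈ Vc) → Side
    side v (yes v∈) = does (g v v∈ ≟ φ v)
    side v (no  _)  = outside

module _ {c ℓ₁ ℓ₂} (ℝ : RealField c ℓ₁ ℓ₂) (G : Graph) where
  open RealField ℝ
  open Graph G

  colourValue : Fin 2 → Carrier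
  colourValue zero       = 0#
  colourValue (suc zero) = 1#

  record IsGreyscale (f : Vertex → Carrier) : Set (ℓ₁ ⊔ ℓ₂) where
    field
      nonNegative : ∀ v → 0# ≤ f v
      atMostOne   : ∀ v → f v ≤ 1#
      attains0    : ∃[ v ] (f v ≈ 0#)
      attains1    : ∃[ v ] (f v ≈ 1#)

  contrastVector : (Vertex → Carrier) → List Carrier
  contrastVector f =
    Sort.sort decTotalOrder (map (λ (u , v) → ∣ f u + - f v ∣) edges)

  Compatible : (Vc : Subset order) → InitialColouring Vc →
               (Vertex → Carrier) → Set ℓ₁
  Compatible Vc g f = ∀ v (v∈ : v ∈ Vc) → f v ≈ colourValue (g v v∈)

  record IsMaximumContrastGreyscale
    (Vc : Subset order) (g : InitialColouring Vc) (f : Vertex → Carrier)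
    : Set (c ⊔ ℓ₁ ⊔ ℓ₂) where
    field
      isGreyscale : IsGreyscale f
      compatible  : Compatible Vc g f
      maximum     : ∀ h → IsGreyscale h → Compatible Vc g h →
                    Lex-≤ _≈_ _≤_ (contrastVector h) (contrastVector f)

{-# OPTIONS --safe #-}
module Submission where

-- Let a be the only vertex of V_c on which g agrees with the 2-colouring φ.
-- Neighbours of a are not in V_c, so giving a its colour under φ, its neighbours ½
-- and every other vertex v the colour opposite to φ v is compatible with g; all its
-- contrasts are at least ½.  (If a is alone in its colour class, this map need not
-- attain both 0 and 1, but then φ itself is compatible.)  By maximality all
-- contrasts of f are at least ½.  So on each edge one end of f is at most ½ and the
-- other at least ½, and rounding the values in (0,½) to 0 and those in (½,1) to 1
-- decreases no contrast.  The sorted contrast vector then does not decrease in any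
-- entry, so by maximality it is unchanged; comparing sums, no contrast changes.
-- Hence rounding moved no vertex.

open import Algebra.Bundles using (module CommutativeMonoid; module CommutativeRing)
open import Defs
open import Data.Fin.Base using (Fin; zero; suc; opposite; _<_)
open import Data.Fin.Properties using (_≟_; _<?_; <-cmp; any?)
open import Data.Fin.Subset using (Subset; Nonempty; _⊂_; ⊤; ∣_∣; _∈_; inside)
open import Data.Fin.Subset.Properties
  using (_∈?_; nonempty?; Empty-unique; ∣⊥∣≡0; x∈p⇒∣p-x∣<∣p∣; x∈p∧x≢y⇒x∈p-y)
open import Data.List.Base using (List; []; _∷_; map; length; foldr; cartesianProduct; allFin)
open import Data.List.Properties using (length-map)
open import Data.List.Membership.Propositional.Properties
  using (∈-filter⁺; ∈-filter⁻; ∈-cartesianProduct⁺; ∈-allFin)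
open import Data.List.Relation.Binary.Lex.NonStrict using (Lex-≤; this; next)
open import Data.List.Relation.Binary.Permutation.Propositional using (↭-sym)
open import Data.List.Relation.Binary.Permutation.Propositional.Properties
  using (All-resp-↭; ↭-length)
import Data.List.Relation.Binary.Permutation.Setoid as PermutationSetoid
import Data.List.Relation.Binary.Permutation.Setoid.Properties as PermutationSetoidProperties
open import Data.List.Relation.Binary.Pointwise as Pointwise using (Pointwise; []; _∷_)
open import Data.List.Relation.Unary.All as All using (All; []; _∷_)
import Data.List.Relation.Unary.All.Properties as All
open import Data.List.Relation.Unary.AllPairs using (_∷_)
open import Data.List.Relation.Unary.Linked using ([]; [-]; _∷_; tail)
import Data.List.Relation.Unary.Sorted.TotalOrder as Sorted
open import Data.List.Relation.Unary.Sorted.TotalOrder.Properties using (Sorted⇒AllPairs; ↗↭↗⇒≋)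
import Data.List.Sort as Sort
open import Data.List.Sort.Base using (module SortingAlgorithm)
open import Data.Nat.Properties using (<-≤-trans; n≮0; ≤-pred; ≤-trans; ≤-reflexive; 0≢1+n)
open import Data.Product.Base using (_×_; _,_; ∃-syntax; proj₁; proj₂; uncurry; map₂; swap)
open import Data.Sum.Base as Sum using (_⊎_; inj₁; inj₂; [_,_]′)
open import Data.Vec.Base using (lookup)
open import Data.Vec.Properties using (lookup∘tabulate; []=⇒lookup; lookup⇒[]=)
open import Data.Vec.Properties.WithK using ([]=-irrelevant)
open import Function.Base using (_∘_; _$_)
open import Level using (_⊔_)
open import Relation.Binary.Bundles using (DecTotalOrder)
open import Relation.Binary.Construct.Closure.ReflexiveTransitive using (Star; ε; _◅_)
open import Relation.Binary.Definitions using (Tri; tri<; tri≈; tri>)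
import Relation.Binary.Reasoning.PartialOrder as PosetReasoning
open import Relation.Binary.PropositionalEquality
  using (_≡_; _≢_; _≗_; refl; sym; trans; cong; subst; ≢-sym)
open import Relation.Nullary using (¬_; Dec; yes; no; contradiction; does)
open import Relation.Nullary.Decidable using (_×-dec_; ¬?; dec-true; decidable-stable)

-- Sorted lists under the lexicographic and the pointwise order.

module SortedLists {a ℓ₁ ℓ₂} (O : DecTotalOrder a ℓ₁ ℓ₂) where
  open DecTotalOrder O hiding (refl) renaming (Carrier to A; trans to ≤-trans′)
  open Sorted totalOrder using (Sorted)
  open Sort O using (sort; sort-↭; sort-↗; sortingAlgorithm)
  open SortingAlgorithm sortingAlgorithm using (sort-↭ₛ)
  open import Data.List.Sort.InsertionSort.Base O using (insert) renaming (sort to isort)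
  open import Data.List.Sort.InsertionSort.Properties O
    using (insertionSort; insert-↗) renaming (sort-↗ to isort-↗)
  open SortingAlgorithm insertionSort using () renaming (sort-↭ₛ to isort-↭ₛ)
  open PermutationSetoid Eq.setoid using (_↭_) renaming (↭-trans to ↭ₛ-trans; ↭-sym to ↭ₛ-sym)
  open import Relation.Binary.Properties.DecTotalOrder O using (≰⇒≥)

  -- The lexicographic order compares first entries first, and the first entry of a sorted list is
  -- its least. Equal lengths exclude an empty `xs` below a nonempty `ys`.
  sorted-lex-bounded : ∀ {t xs ys} → Sorted ys → length xs ≡ length ys →
                       Lex-≤ _≈_ _≤_ xs ys → All (t ≤_) xs → All (t ≤_) ys
  sorted-lex-bounded {ys = []} _ _ _ _ = []
  sorted-lex-bounded {t} {x ∷ xs} {y ∷ ys} ys↗ _ x≤ᴸy (t≤x ∷ _)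
    with y≤ys ∷ _ ← Sorted⇒AllPairs totalOrder ys↗ =
    t≤y ∷ All.map (≤-trans′ t≤y) y≤ys
    where
    head-≤ : Lex-≤ _≈_ _≤_ (x ∷ xs) (y ∷ ys) → x ≤ y
    head-≤ (this (x≤y , _)) = x≤y
    head-≤ (next x≈y _)     = reflexive x≈y
    t≤y = ≤-trans′ t≤x (head-≤ x≤ᴸy)

  sort-lex-bounded : ∀ {t xs ys} → length xs ≡ length ys →
                     Lex-≤ _≈_ _≤_ (sort xs) (sort ys) → All (t ≤_) xs → All (t ≤_) ys
  sort-lex-bounded {t} {xs} {ys} eq xs≤ys t≤xs =
    All-resp-↭ (sort-↭ ys) $
    sorted-lex-bounded (sort-↗ ys)
      (trans (↭-length (sort-↭ xs)) (trans eq (sym (↭-length (sort-↭ ys)))))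
      xs≤ys (All-resp-↭ (↭-sym (sort-↭ xs)) t≤xs)

  -- The library's sort is abstract, so its monotonicity is obtained from insertion sort:
  -- sorted permutations of the same list agree up to ≈.
  insert-head : ∀ {x xs} → Sorted (x ∷ xs) → insert x xs ≡ x ∷ xs
  insert-head [-] = refl
  insert-head {x} {y ∷ ys} (x≤y ∷ _) rewrite dec-true (x ≤? y) x≤y = refl

  insert-mono : ∀ {x y xs ys} → Sorted xs → Sorted ys → x ≤ y → Pointwise _≤_ xs ys →
                Pointwise _≤_ (insert x xs) (insert y ys)
  insert-mono _ _ x≤y [] = x≤y ∷ []
  insert-mono {x} {y} {a ∷ as} {b ∷ bs} as↗ bs↗ x≤y (a≤b ∷ as≤bs)
    with x ≤? a | y ≤? b
  ... | yes x≤a | yes y≤b = x≤y ∷ a≤b ∷ as≤bs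
  ... | no  x≰a | no  y≰b = a≤b ∷ insert-mono (tail as↗) (tail bs↗) x≤y as≤bs
  -- The insertions stop at different depths. The tail `a ∷ as` is read as `insert a as`, so
  -- induction applies with `a ≤ b ≤ y`; the last case is dual.
  ... | yes x≤a | no  y≰b = ≤-trans′ x≤a a≤b ∷
    subst (λ l → Pointwise _≤_ l (insert y bs)) (insert-head as↗)
      (insert-mono (tail as↗) (tail bs↗) (≤-trans′ a≤b (≰⇒≥ y≰b)) as≤bs)
  ... | no  x≰a | yes y≤b = ≤-trans′ (≰⇒≥ x≰a) x≤y ∷
    subst (Pointwise _≤_ (insert x as)) (insert-head bs↗)
      (insert-mono (tail as↗) (tail bs↗) (≤-trans′ x≤y y≤b) as≤bs)

  module _ {e} {E : Set e} {F G : E → A} where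

    isort-mono : ∀ {es} → All (λ e → F e ≤ G e) es →
                 Pointwise _≤_ (isort (map F es)) (isort (map G es))
    isort-mono []          = []
    isort-mono {_ ∷ es} (p ∷ ps) =
      insert-mono (isort-↗ (map F es)) (isort-↗ (map G es)) p (isort-mono ps)

    sort-mono : ∀ {es} → All (λ e → F e ≤ G e) es →
                Pointwise _≤_ (sort (map F es)) (sort (map G es))
    sort-mono {es} ps =
      Pointwise.transitive (λ x≈y y≤z → ≤-respˡ-≈ (Eq.sym x≈y) y≤z)
        (sort≋isort (map F es))
        (Pointwise.transitive (λ x≤y y≈z → ≤-respʳ-≈ y≈z x≤y)
          (isort-mono ps)
          (Pointwise.symmetric Eq.sym (sort≋isort (map G es))))
      where
      sort≋isort : ∀ xs → Pointwise _≈_ (sort xs) (isort xs)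
      sort≋isort xs = ↗↭↗⇒≋ totalOrder (sort-↗ xs) (isort-↗ xs)
        (↭ₛ-trans (sort-↭ₛ xs) (↭ₛ-sym (isort-↭ₛ xs)))

  -- At a first difference `ys` would be strictly smaller, against the lexicographic comparison.
  lex-antisym : ∀ {xs ys} → Pointwise _≤_ xs ys → Lex-≤ _≈_ _≤_ ys xs → Pointwise _≈_ ys xs
  lex-antisym []            _                  = []
  lex-antisym (x≤y ∷ _)     (this (y≤x , y≉x)) = contradiction (antisym y≤x x≤y) y≉x
  lex-antisym (_   ∷ xs≤ys) (next y≈x ys≤xs)   = y≈x ∷ lex-antisym xs≤ys ys≤xs

  -- Sorting forgets which entry came from which index, so at this stage only the multisets of
  -- values are known to agree.
  sort-lex-↭ : ∀ {e} {E : Set e} {F G : E → A} {es} → All (λ e → F e ≤ G e) es →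
               Lex-≤ _≈_ _≤_ (sort (map G es)) (sort (map F es)) → map G es ↭ map F es
  sort-lex-↭ {F = F} {G} {es} ps G≤F =
    ↭ₛ-trans (↭ₛ-sym (sort-↭ₛ (map G es)))
      (↭ₛ-trans (PermutationSetoid.refl (lex-antisym (sort-mono ps) G≤F)) (sort-↭ₛ (map F es)))

-- Ordered-field arithmetic, distances and rounding.

module OrderedField {c ℓ₁ ℓ₂} (ℝ : RealField c ℓ₁ ℓ₂) where
  open RealField ℝ renaming (∣_∣ to abs)
  open CommutativeRing commutativeRing using
    (+-comm; +-assoc; +-cong; +-congˡ; +-identityˡ; +-identityʳ;
     -‿inverseˡ; -‿inverseʳ; distribʳ; *-identityˡ; setoid;
     +-commutativeMonoid; ring)
  open import Algebra.Properties.Ring ring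
    using (-1*x≈-x; -‿+-comm; -0#≈0#)
    renaming (-‿involutive to neg-involutive; -‿injective to neg-injective)
  open DecTotalOrder decTotalOrder using
    (_≤?_; antisym; total; totalOrder; poset; reflexive; ≤-respˡ-≈; ≤-respʳ-≈; module Eq)
    renaming (refl to ≤-refl; trans to ≤-trans′; _≟_ to _≈?_)
  open SortedLists decTotalOrder
  open PosetReasoning poset
  import Algebra.Construct.NaturalChoice.Max totalOrder as Max

  +-mono-≤ : ∀ {w x y z} → w ≤ x → y ≤ z → w + y ≤ x + z
  +-mono-≤ {w} {x} {y} {z} w≤x y≤z = begin
    w + y ≤⟨ +-monoˡ-≤ y w≤x ⟩
    x + y ≈⟨ +-comm x y ⟩
    y + x ≤⟨ +-monoˡ-≤ x y≤z ⟩
    z + x ≈⟨ +-comm z x ⟩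
    x + z ∎

  x+z-z≈x : ∀ x z → x + z + - z ≈ x
  x+z-z≈x x z = begin-equality
    x + z + - z   ≈⟨ +-assoc x z (- z) ⟩
    x + (z + - z) ≈⟨ +-congˡ (-‿inverseʳ z) ⟩
    x + 0#        ≈⟨ +-identityʳ x ⟩
    x             ∎

  x-z+z≈x : ∀ x z → x + - z + z ≈ x
  x-z+z≈x x z = begin-equality
    x + - z + z   ≈⟨ +-assoc x (- z) z ⟩
    x + (- z + z) ≈⟨ +-congˡ (-‿inverseˡ z) ⟩
    x + 0#        ≈⟨ +-identityʳ x ⟩
    x             ∎

  +-cancelʳ-≤ : ∀ z {x y} → x + z ≤ y + z → x ≤ y
  +-cancelʳ-≤ z {x} {y} p = begin
    x           ≈⟨ x+z-z≈x x z ⟨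
    x + z + - z ≤⟨ +-monoˡ-≤ (- z) p ⟩
    y + z + - z ≈⟨ x+z-z≈x y z ⟩
    y           ∎

  neg-antimono : ∀ {x y} → x ≤ y → - y ≤ - x
  neg-antimono {x} {y} x≤y = +-cancelʳ-≤ y $ begin
    - y + y ≈⟨ -‿inverseˡ y ⟩
    0#      ≈⟨ -‿inverseˡ x ⟨
    - x + x ≤⟨ +-mono-≤ ≤-refl x≤y ⟩
    - x + y ∎

  -- Replacing one summand on the right by its upper bound allows it to be cancelled, which leaves
  -- the reverse inequality for the other.
  squeeze : ∀ {x x′ y y′} → x ≤ x′ → y ≤ y′ → x′ + y′ ≤ x + y → x′ ≈ x × y′ ≈ y
  squeeze {x} {x′} {y} {y′} x≤x′ y≤y′ p =
    antisym (+-cancelʳ-≤ y (≤-trans′ (+-mono-≤ ≤-refl y≤y′) p)) x≤x′ ,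
    antisym (+-cancelʳ-≤ x (begin
      y′ + x  ≤⟨ +-mono-≤ ≤-refl x≤x′ ⟩
      y′ + x′ ≈⟨ +-comm y′ x′ ⟩
      x′ + y′ ≤⟨ p ⟩
      x + y   ≈⟨ +-comm x y ⟩
      y + x   ∎)) y≤y′

  module _ {e} {E : Set e} {F G : E → Carrier} where

    private
      sum : List Carrier → Carrier
      sum = foldr _+_ 0#

    sum-mono : ∀ {es} → All (λ e → F e ≤ G e) es → sum (map F es) ≤ sum (map G es)
    sum-mono []       = ≤-refl
    sum-mono (p ∷ ps) = +-mono-≤ p (sum-mono ps)

    sum-squeeze : ∀ {es} → All (λ e → F e ≤ G e) es → sum (map G es) ≤ sum (map F es) →
                  All (λ e → G e ≈ F e) es
    sum-squeeze []       _  = []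
    sum-squeeze (p ∷ ps) le with squeeze p (sum-mono ps) le
    ... | eq , eqs = eq ∷ sum-squeeze ps (reflexive eqs)

    -- Equal multisets have equal sums, and termwise comparable families with equal sums agree term
    -- by term. This recovers the indexing lost in sorting.
    sort-lex-squeeze : ∀ {es} → All (λ e → F e ≤ G e) es →
      Lex-≤ _≈_ _≤_ (Sort.sort decTotalOrder (map G es)) (Sort.sort decTotalOrder (map F es)) →
      All (λ e → G e ≈ F e) es
    sort-lex-squeeze ps G≤F = sum-squeeze ps $ reflexive $
      PermutationSetoidProperties.foldr-commMonoid setoid
        (CommutativeMonoid.isCommutativeMonoid +-commutativeMonoid) (sort-lex-↭ ps G≤F)

  -- If `1# ≤ 0#` then `- 1#` is nonnegative, and so is its square `1#`.
  0≤1 : 0# ≤ 1#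
  0≤1 with total 0# 1#
  ... | inj₁ 0≤1′ = 0≤1′
  ... | inj₂ 1≤0 = begin
    0#            ≤⟨ *-nonNegative 0≤-1 0≤-1 ⟩
    - 1# * - 1#   ≈⟨ -1*x≈-x (- 1#) ⟩
    - - 1#        ≈⟨ neg-involutive 1# ⟩
    1#            ∎
    where
    0≤-1 : 0# ≤ - 1#
    0≤-1 = ≤-respˡ-≈ -0#≈0# (neg-antimono 1≤0)

  -- The inverse is specified only for nonzero elements, so `1# + 1#` must first be seen to be
  -- nonzero; it is at least `1#`.
  ½+½≈1 : ½ + ½ ≈ 1#
  ½+½≈1 = begin-equality
    ½ + ½             ≈⟨ +-cong (*-identityˡ ½) (*-identityˡ ½) ⟨
    1# * ½ + 1# * ½   ≈⟨ distribʳ ½ 1# 1# ⟨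
    (1# + 1#) * ½     ≈⟨ *-inverse (1# + 1#) 2≉0 ⟩
    1#                ∎
    where
    2≉0 : ¬ (1# + 1# ≈ 0#)
    2≉0 2≈0 = 0≉1 $ antisym 0≤1 $ begin
      1#       ≈⟨ +-identityˡ 1# ⟨
      0# + 1#  ≤⟨ +-monoˡ-≤ 1# 0≤1 ⟩
      1# + 1#  ≈⟨ 2≈0 ⟩
      0#       ∎

  ½≰0 : ¬ (½ ≤ 0#)
  ½≰0 ½≤0 = 0≉1 $ antisym 0≤1 $ begin
    1#       ≈⟨ ½+½≈1 ⟨
    ½ + ½    ≤⟨ +-mono-≤ ½≤0 ½≤0 ⟩
    0# + 0#  ≈⟨ +-identityˡ 0# ⟩
    0#       ∎

  0≤½ : 0# ≤ ½
  0≤½ = [ (λ p → p) , (λ ½≤0 → contradiction ½≤0 ½≰0) ]′ (total 0# ½)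

  ½≤1 : ½ ≤ 1#
  ½≤1 = begin
    ½      ≈⟨ +-identityˡ ½ ⟨
    0# + ½ ≤⟨ +-monoˡ-≤ ½ 0≤½ ⟩
    ½ + ½  ≈⟨ ½+½≈1 ⟩
    1#     ∎

  0+½≤½ : 0# + ½ ≤ ½
  0+½≤½ = reflexive (+-identityˡ ½)

  neg-diff : ∀ x y → - (x + - y) ≈ y + - x
  neg-diff x y = begin-equality
    - (x + - y)   ≈⟨ -‿+-comm x (- y) ⟨
    - x + - - y   ≈⟨ +-congˡ (neg-involutive y) ⟩
    - x + y       ≈⟨ +-comm (- x) y ⟩
    y + - x       ∎

  dist-comm : ∀ x y → abs (x + - y) ≈ abs (y + - x)
  dist-comm x y = begin-equality
    max (x + - y) (- (x + - y))  ≈⟨ Max.⊔-cong (Eq.sym (neg-diff y x)) (neg-diff x y) ⟩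
    max (- (y + - x)) (y + - x)  ≈⟨ Max.⊔-comm _ _ ⟩
    max (y + - x) (- (y + - x))  ∎

  dist-≤ : ∀ {x y} → x ≤ y → abs (x + - y) ≈ y + - x
  dist-≤ {x} {y} x≤y = Eq.trans (Max.x≤y⇒x⊔y≈y (begin
    x + - y      ≤⟨ +-monoˡ-≤ (- y) x≤y ⟩
    y + - y      ≈⟨ -‿inverseʳ y ⟩
    0#           ≈⟨ -‿inverseʳ x ⟨
    x + - x      ≤⟨ +-monoˡ-≤ (- x) x≤y ⟩
    y + - x      ≈⟨ neg-diff x y ⟨
    - (x + - y)  ∎)) (neg-diff x y)

  ½≤dist : ∀ {x y} → x + ½ ≤ y → ½ ≤ abs (x + - y)
  ½≤dist {x} {y} p = begin
    ½            ≤⟨ +-cancelʳ-≤ x (begin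
        ½ + x        ≈⟨ +-comm ½ x ⟩
        x + ½        ≤⟨ p ⟩
        y            ≈⟨ x-z+z≈x y x ⟨
        y + - x + x  ∎) ⟩
    y + - x      ≈⟨ dist-≤ x≤y ⟨
    abs (x + - y) ∎
    where
    x≤y : x ≤ y
    x≤y = begin
      x       ≈⟨ +-identityʳ x ⟨
      x + 0#  ≤⟨ +-mono-≤ ≤-refl 0≤½ ⟩
      x + ½   ≤⟨ p ⟩
      y       ∎

  ½≤dist⁻¹ : ∀ {x y} → x ≤ y → ½ ≤ abs (x + - y) → x + ½ ≤ y
  ½≤dist⁻¹ {x} {y} x≤y p = begin
    x + ½             ≤⟨ +-mono-≤ ≤-refl p ⟩
    x + abs (x + - y) ≈⟨ +-congˡ (dist-≤ x≤y) ⟩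
    x + (y + - x)     ≈⟨ +-comm x _ ⟩
    y + - x + x       ≈⟨ x-z+z≈x y x ⟩
    y                 ∎

  -- Testing for `½` first makes the second test strict. On the unit interval, values move only away
  -- from `½`, and the fixed points are 0, ½ and 1.
  round : Carrier → Carrier
  round x with x ≈? ½ | x ≤? ½
  ... | yes _ | _     = ½
  ... | no  _ | yes _ = 0#
  ... | no  _ | no  _ = 1#

  round-image : ∀ x → (round x ≈ 0#) ⊎ (round x ≈ ½) ⊎ (round x ≈ 1#)
  round-image x with x ≈? ½ | x ≤? ½
  ... | yes _ | _     = inj₂ (inj₁ Eq.refl)
  ... | no  _ | yes _ = inj₁ Eq.refl
  ... | no  _ | no  _ = inj₂ (inj₂ Eq.refl)

  round-≤ : ∀ {x} → 0# ≤ x → x ≤ ½ → round x ≤ x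
  round-≤ {x} 0≤x x≤½ with x ≈? ½ | x ≤? ½
  ... | yes x≈½ | _       = reflexive (Eq.sym x≈½)
  ... | no  _   | yes _   = 0≤x
  ... | no  _   | no  x≰½ = contradiction x≤½ x≰½

  round-≥ : ∀ {x} → x ≤ 1# → ½ ≤ x → x ≤ round x
  round-≥ {x} x≤1 ½≤x with x ≈? ½ | x ≤? ½
  ... | yes x≈½ | _       = reflexive x≈½
  ... | no  x≉½ | yes x≤½ = contradiction (antisym x≤½ ½≤x) x≉½
  ... | no  _   | no  _   = x≤1

  0≤round : ∀ x → 0# ≤ round x
  0≤round x with x ≈? ½ | x ≤? ½
  ... | yes _ | _     = 0≤½
  ... | no  _ | yes _ = ≤-refl
  ... | no  _ | no  _ = 0≤1

  round≤1 : ∀ x → round x ≤ 1#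
  round≤1 x with x ≈? ½ | x ≤? ½
  ... | yes _ | _     = ½≤1
  ... | no  _ | yes _ = 0≤1
  ... | no  _ | no  _ = ≤-refl

  round-0 : ∀ {x} → x ≈ 0# → round x ≈ 0#
  round-0 {x} x≈0 = antisym
    (≤-respʳ-≈ x≈0 (round-≤ (reflexive (Eq.sym x≈0)) (≤-respˡ-≈ (Eq.sym x≈0) 0≤½)))
    (0≤round x)

  round-1 : ∀ {x} → x ≈ 1# → round x ≈ 1#
  round-1 {x} x≈1 = antisym (round≤1 x)
    (≤-respˡ-≈ x≈1 (round-≥ (reflexive x≈1) (≤-respʳ-≈ (Eq.sym x≈1) ½≤1)))

  -- The second component is rigidity: once maximality shows that a contrast is unchanged, it yields
  -- that neither end moved.
  RoundsApart : Carrier → Carrier → Set _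
  RoundsApart x y = abs (x + - y) ≤ abs (round x + - round y) ×
    (abs (round x + - round y) ≈ abs (x + - y) → round x ≈ x × round y ≈ y)

  roundsApart-sym : ∀ {x y} → RoundsApart x y → RoundsApart y x
  roundsApart-sym {x} {y} (le , rigid) =
    ≤-respˡ-≈ (dist-comm x y) (≤-respʳ-≈ (dist-comm (round x) (round y)) le) ,
    λ eq → swap (rigid (Eq.trans (dist-comm (round x) (round y))
                          (Eq.trans eq (dist-comm y x))))

  -- A gap of ½ forces x ≤ ½ ≤ y, so rounding moves the two values away from each other.
  roundsApart-≤ : ∀ {x y} → 0# ≤ x → y ≤ 1# → x ≤ y → ½ ≤ abs (x + - y) → RoundsApart x y
  roundsApart-≤ {x} {y} 0≤x y≤1 x≤y gap =
    (begin
      abs (x + - y)             ≈⟨ dist-≤ x≤y ⟩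
      y + - x                   ≤⟨ +-mono-≤ y≤ry -x≤-rx ⟩
      round y + - round x       ≈⟨ dist-≤ rx≤ry ⟨
      abs (round x + - round y) ∎) ,
    -- Both ends move outwards, so an unchanged distance leaves room for neither move.
    λ eq → let ry≈y , -rx≈-x = squeeze y≤ry -x≤-rx (begin
                 round y + - round x       ≈⟨ dist-≤ rx≤ry ⟨
                 abs (round x + - round y) ≈⟨ eq ⟩
                 abs (x + - y)             ≈⟨ dist-≤ x≤y ⟩
                 y + - x                   ∎)
           in neg-injective -rx≈-x , ry≈y
    where
    x+½≤y : x + ½ ≤ y
    x+½≤y = ½≤dist⁻¹ x≤y gap

    rx≤x : round x ≤ x
    rx≤x = round-≤ 0≤x $ +-cancelʳ-≤ ½ $ begin
      x + ½  ≤⟨ x+½≤y ⟩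
      y      ≤⟨ y≤1 ⟩
      1#     ≈⟨ ½+½≈1 ⟨
      ½ + ½  ∎

    y≤ry : y ≤ round y
    y≤ry = round-≥ y≤1 $ begin
      ½       ≈⟨ +-identityˡ ½ ⟨
      0# + ½  ≤⟨ +-monoˡ-≤ ½ 0≤x ⟩
      x + ½   ≤⟨ x+½≤y ⟩
      y       ∎

    -x≤-rx : - x ≤ - round x
    -x≤-rx = neg-antimono rx≤x

    rx≤ry : round x ≤ round y
    rx≤ry = ≤-trans′ rx≤x (≤-trans′ x≤y y≤ry)

  roundsApart : ∀ {x y} → 0# ≤ x → x ≤ 1# → 0# ≤ y → y ≤ 1# → ½ ≤ abs (x + - y) →
                RoundsApart x y
  roundsApart {x} {y} 0≤x x≤1 0≤y y≤1 gap with total x y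
  ... | inj₁ x≤y = roundsApart-≤ 0≤x y≤1 x≤y gap
  ... | inj₂ y≤x =
    roundsApart-sym (roundsApart-≤ 0≤y x≤1 y≤x (≤-respʳ-≈ (dist-comm x y) gap))


-- Two colours and one-element subsets.

≢-≢⇒≡ : {i j k : Fin 2} → i ≢ j → k ≢ j → i ≡ k
≢-≢⇒≡ {zero}     {zero}     i≢j _ = contradiction refl i≢j
≢-≢⇒≡ {suc zero} {suc zero} i≢j _ = contradiction refl i≢j
≢-≢⇒≡ {zero}     {suc zero} {zero}     _ _   = refl
≢-≢⇒≡ {zero}     {suc zero} {suc zero} _ k≢j = contradiction refl k≢j
≢-≢⇒≡ {suc zero} {zero}     {zero}     _ k≢j = contradiction refl k≢j
≢-≢⇒≡ {suc zero} {zero}     {suc zero} _ _   = refl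

opposite-≢ : (i : Fin 2) → opposite i ≢ i
opposite-≢ zero       ()
opposite-≢ (suc zero) ()

opposite-injective : {i j : Fin 2} → opposite i ≡ opposite j → i ≡ j
opposite-injective {i} {j} eq = ≢-≢⇒≡ (≢-sym (opposite-≢ i))
  (λ j≡ → opposite-≢ j (sym (trans j≡ eq)))

singleton-unique : ∀ {n} {S : Subset n} → ∣ S ∣ ≡ 1 → ∃[ a ] a ∈ S × (∀ {v} → v ∈ S → v ≡ a)
singleton-unique {n} {S} ∣S∣≡1 with nonempty? S
... | no empty = contradiction
  (trans (sym (∣⊥∣≡0 n)) (trans (cong ∣_∣ (sym (Empty-unique empty))) ∣S∣≡1)) 0≢1+n
... | yes (a , a∈S) = a , a∈S , unique
  where
  unique : ∀ {v} → v ∈ S → v ≡ a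
  unique {v} v∈S with v ≟ a
  ... | yes v≡a = v≡a
  -- Removing `a` leaves at most 0 elements, and removing `v` as well would leave fewer still.
  ... | no  v≢a = contradiction
    (<-≤-trans (x∈p⇒∣p-x∣<∣p∣ (x∈p∧x≢y⇒x∈p-y v∈S v≢a))
      (≤-pred (≤-trans (x∈p⇒∣p-x∣<∣p∣ a∈S) (≤-reflexive ∣S∣≡1)))) n≮0

-- Edge lists, neighbours and agreement sets.

module GraphLemmas (G : Graph) where
  open Graph G

  private
    edge? : (e : Vertex × Vertex) → Dec (proj₁ e < proj₂ e × proj₁ e ~ proj₂ e)
    edge? (u , v) = (u <? v) ×-dec (u ~? v)

  edges-all⁺ : ∀ {p} {P : Vertex → Vertex → Set p} → (∀ {u v} → u ~ v → P u v) →
               All (uncurry P) edges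
  edges-all⁺ p = All.tabulate λ e∈ → p (proj₂ (proj₂ (∈-filter⁻ edge? {xs = cartesianProduct (allFin order) (allFin order)} e∈)))

  -- Each edge is listed with its smaller end first; symmetry of `P` supplies the other orientation.
  edges-all⁻ : ∀ {p} {P : Vertex → Vertex → Set p} → (∀ {u v} → P u v → P v u) →
               All (uncurry P) edges → ∀ {u v} → u ~ v → P u v
  edges-all⁻ {P = P} P-sym ps {u} {v} u~v = go (<-cmp u v)
    where
    increasing : ∀ {u v} → u < v → u ~ v → P u v
    increasing {u} {v} u<v u~v = All.lookup ps
      (∈-filter⁺ edge? (∈-cartesianProduct⁺ (∈-allFin u) (∈-allFin v)) (u<v , u~v))

    go : Tri (u < v) (u ≡ v) (v < u) → P u v
    go (tri< u<v _ _)  = increasing u<v u~v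
    go (tri≈ _ refl _) = contradiction u~v (~-irrefl u)
    go (tri> _ _ v<u)  = P-sym (increasing v<u (~-sym u~v))

  -- Every vertex differs from `p` or from `q`, so a walk to that one has a first step.
  connected⇒neighbour : Connected → ∀ {p q : Vertex} → p ≢ q → ∀ v → ∃[ w ] v ~ w
  connected⇒neighbour conn {p} {q} p≢q v = go (v ≟ p)
    where
    firstStep : ∀ {x y} → x ≢ y → Star _~_ x y → ∃[ w ] x ~ w
    firstStep x≢y ε       = contradiction refl x≢y
    firstStep _   (e ◅ _) = _ , e

    go : Dec (v ≡ p) → ∃[ w ] v ~ w
    go (no  v≢p)  = firstStep v≢p (conn v p)
    go (yes refl) = firstStep p≢q (conn v q)

  module _ (Vc : Subset order) (g : InitialColouring Vc) (φ : Vertex → Fin 2) where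

    agreement⁻ : ∀ {v} → v ∈ agreement Vc g φ → ∃[ v∈ ] g v v∈ ≡ φ v
    agreement⁻ {v} v∈A
      with eq ← trans (sym (lookup∘tabulate _ v)) ([]=⇒lookup v∈A)
      with v ∈? Vc
    ... | yes v∈ = v∈ , does-true (g v v∈ ≟ φ v) eq
      where
      does-true : ∀ {A : Set} (A? : Dec A) → does A? ≡ inside → A
      does-true (yes a) _ = a

    agreement⁺ : ∀ {v} (v∈ : v ∈ Vc) → g v v∈ ≡ φ v → v ∈ agreement Vc g φ
    -- The trivial trans determines the local function inside agreement, which has no name here.
    agreement⁺ {v} v∈ gv≡φv
      with eq ← trans (refl {x = lookup (agreement Vc g φ) v}) (lookup∘tabulate _ v)
      with v ∈? Vc
    -- The colouring takes a membership proof as argument; uniqueness of such proofs identifies the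
    -- two values.
    ... | yes v∈′ = lookup⇒[]= v _ (trans eq (dec-true (g v v∈′ ≟ φ v)
                      (trans (cong (g v) ([]=-irrelevant v∈′ v∈)) gv≡φv)))
    ... | no  v∉  = contradiction v∈ v∉

-- Greyscales with every contrast at least one half.

module _ {c ℓ₁ ℓ₂} (ℝ : RealField c ℓ₁ ℓ₂) (G : Graph) where
  open RealField ℝ renaming (∣_∣ to abs)
  open DecTotalOrder decTotalOrder using (reflexive; ≤-respʳ-≈; module Eq)
    renaming (refl to ≤-refl; trans to ≤-trans′)
  open OrderedField ℝ
  open Graph G
  open GraphLemmas G

  private
    value : Fin 2 → Carrier
    value = colourValue ℝ G

    0≤value : ∀ i → 0# ≤ value i
    0≤value zero       = ≤-refl
    0≤value (suc zero) = 0≤1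

    value≤1 : ∀ i → value i ≤ 1#
    value≤1 zero       = 0≤1
    value≤1 (suc zero) = ≤-refl

  Gap : Carrier → Carrier → Set ℓ₂
  Gap x y = ½ ≤ abs (x + - y)

  gap-sym : ∀ {x y} → Gap x y → Gap y x
  gap-sym {x} {y} = ≤-respʳ-≈ (dist-comm x y)

  value-gap-½ : ∀ i → Gap (value i) ½
  value-gap-½ zero       = ½≤dist 0+½≤½
  value-gap-½ (suc zero) = gap-sym (½≤dist (reflexive ½+½≈1))

  value-gap : ∀ {i j} → i ≢ j → Gap (value i) (value j)
  value-gap {zero}     {suc zero} _ = ½≤dist (≤-trans′ 0+½≤½ ½≤1)
  value-gap {suc zero} {zero}     _ = gap-sym (½≤dist (≤-trans′ 0+½≤½ ½≤1))
  value-gap {zero}     {zero}     i≢j = contradiction refl i≢j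
  value-gap {suc zero} {suc zero} i≢j = contradiction refl i≢j

  distinct-values⇒attained : ∀ {h : Vertex → Carrier} {u v i j} → i ≢ j →
    h u ≡ value i → h v ≡ value j → (∃[ w ] (h w ≈ 0#)) × (∃[ w ] (h w ≈ 1#))
  distinct-values⇒attained {i = zero}     {suc zero} _ hu hv =
    (_ , Eq.reflexive hu) , (_ , Eq.reflexive hv)
  distinct-values⇒attained {i = suc zero} {zero}     _ hu hv =
    (_ , Eq.reflexive hv) , (_ , Eq.reflexive hu)
  distinct-values⇒attained {i = zero}     {zero}     i≢j _ _ = contradiction refl i≢j
  distinct-values⇒attained {i = suc zero} {suc zero} i≢j _ _ = contradiction refl i≢j

  isGreyscale : ∀ {h : Vertex → Carrier} {u v i j} → (∀ v → 0# ≤ h v) → (∀ v → h v ≤ 1#) →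
    i ≢ j → h u ≡ value i → h v ≡ value j → IsGreyscale ℝ G h
  isGreyscale {h} 0≤h h≤1 i≢j hu hv
    with attains0 , attains1 ← distinct-values⇒attained {h} i≢j hu hv = record
    { nonNegative = 0≤h ; atMostOne = h≤1 ; attains0 = attains0 ; attains1 = attains1 }

  module Halved (φ : Vertex → Fin 2) (φ-proper : ProperColouring φ) (a : Vertex) where

    -- The value `½` on the neighbours of `a` absorbs the switch from `φ` at `a` to the opposite
    -- colouring further out.
    halved : Vertex → Carrier
    halved v with v ≟ a | v ~? a
    ... | yes _ | _     = value (φ a)
    ... | no  _ | yes _ = ½
    ... | no  _ | no  _ = value (opposite (φ v))

    halved-a : halved a ≡ value (φ a)
    halved-a with a ≟ a
    ... | yes _  = refl
    ... | no a≢a = contradiction refl a≢a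

    halved-near : ∀ {v} → v ~ a → halved v ≡ ½
    halved-near {v} v~a with v ≟ a | v ~? a
    ... | yes refl | _       = contradiction v~a (~-irrefl a)
    ... | no _     | yes _   = refl
    ... | no _     | no v≁a = contradiction v~a v≁a

    halved-far : ∀ {v} → v ≢ a → ¬ (v ~ a) → halved v ≡ value (opposite (φ v))
    halved-far {v} v≢a v≁a with v ≟ a | v ~? a
    ... | yes v≡a | _       = contradiction v≡a v≢a
    ... | no _    | yes v~a = contradiction v~a v≁a
    ... | no _    | no _    = refl

    0≤halved : ∀ v → 0# ≤ halved v
    0≤halved v with v ≟ a | v ~? a
    ... | yes _ | _     = 0≤value (φ a)
    ... | no  _ | yes _ = 0≤½
    ... | no  _ | no  _ = 0≤value (opposite (φ v))

    halved≤1 : ∀ v → halved v ≤ 1#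
    halved≤1 v with v ≟ a | v ~? a
    ... | yes _ | _     = value≤1 (φ a)
    ... | no  _ | yes _ = ½≤1
    ... | no  _ | no  _ = value≤1 (opposite (φ v))

    -- An end in the class of `a` may be `a` but not a neighbour of `a`; for the other end it is the
    -- reverse. So at most one end has value `½`.
    halved-gap-from-class : ∀ {u v} → φ u ≡ φ a → u ~ v → Gap (halved u) (halved v)
    halved-gap-from-class {u} {v} φu≡φa u~v = go (u ≟ a) (v ~? a)
      where
      u≁a : ¬ (u ~ a)
      u≁a u~a = φ-proper u~a φu≡φa

      v≢a : v ≢ a
      v≢a refl = u≁a u~v

      go : Dec (u ≡ a) → Dec (v ~ a) → Gap (halved u) (halved v)
      go (yes refl) _ rewrite halved-a | halved-near (~-sym u~v) = value-gap-½ (φ a)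
      go (no u≢a) (yes v~a) rewrite halved-far u≢a u≁a | halved-near v~a =
        value-gap-½ (opposite (φ u))
      go (no u≢a) (no v≁a) rewrite halved-far u≢a u≁a | halved-far v≢a v≁a =
        value-gap (φ-proper u~v ∘ opposite-injective)

    -- Exactly one end of an edge lies in the colour class of `a`, so the edge can be oriented to
    -- start there.
    halved-gap : ∀ {u v} → u ~ v → Gap (halved u) (halved v)
    halved-gap {u} {v} u~v with φ u ≟ φ a
    ... | yes φu≡φa = halved-gap-from-class φu≡φa u~v
    ... | no  φu≢φa = gap-sym (halved-gap-from-class
      (≢-≢⇒≡ (≢-sym (φ-proper u~v)) (≢-sym φu≢φa)) (~-sym u~v))

  module _ {Vc : Subset order} {g : InitialColouring Vc} where

    -- The competitor against which `f` is tested. Two constructions supply it, according to whether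
    -- `a` is alone in its colour class.
    record WideGreyscale : Set (c ⊔ ℓ₁ ⊔ ℓ₂) where
      field
        colour     : Vertex → Carrier
        greyscale  : IsGreyscale ℝ G colour
        compatible : Compatible ℝ G Vc g colour
        gap        : ∀ {u v} → u ~ v → Gap (colour u) (colour v)

    module _ {f : Vertex → Carrier} (f-max : IsMaximumContrastGreyscale ℝ G Vc g f) where
      open IsMaximumContrastGreyscale f-max
        renaming (isGreyscale to f-greyscale; compatible to f-compatible)
      open IsGreyscale f-greyscale

      -- The values 0 and 1 are both attained, necessarily at two distinct vertices.
      maximum⇒neighbour : Connected → ∀ v → ∃[ w ] v ~ w
      maximum⇒neighbour conn with p , fp≈0 ← attains0 | q , fq≈1 ← attains1 =
        connected⇒neighbour conn {p} {q}
          λ { refl → 0≉1 (Eq.trans (Eq.sym fp≈0) fq≈1) }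

      maximum-gap : WideGreyscale → ∀ {u v} → u ~ v → Gap (f u) (f v)
      maximum-gap h = edges-all⁻ gap-sym $ All.map⁻ $
        SortedLists.sort-lex-bounded decTotalOrder
          (trans (length-map _ edges) (sym (length-map _ edges)))
          (maximum colour greyscale compatible)
          (All.map⁺ (edges-all⁺ gap))
        where open WideGreyscale h

      round-greyscale : IsGreyscale ℝ G (round ∘ f)
      round-greyscale = record
        { nonNegative = 0≤round ∘ f
        ; atMostOne   = round≤1 ∘ f
        ; attains0    = map₂ round-0 attains0
        ; attains1    = map₂ round-1 attains1
        }

      round-compatible : Compatible ℝ G Vc g (round ∘ f)
      round-compatible v v∈ with g v v∈ | f-compatible v v∈
      ... | zero     | fv≈0 = round-0 fv≈0
      ... | suc zero | fv≈1 = round-1 fv≈1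

      -- The rounded map is itself an admissible competitor with no smaller contrast on any edge, so
      -- maximality makes all contrasts equal and rigidity fixes the ends.
      gap⇒round-fixed : (∀ {u v} → u ~ v → Gap (f u) (f v)) →
                        ∀ {u v} → u ~ v → round (f u) ≈ f u
      gap⇒round-fixed f-gap {u} {v} u~v = proj₁ (proj₂ (apart u~v) (same-contrast u~v))
        where
        apart : ∀ {u v} → u ~ v → RoundsApart (f u) (f v)
        apart {u} {v} u~v = roundsApart (nonNegative u) (atMostOne u)
          (nonNegative v) (atMostOne v) (f-gap u~v)

        same-contrast : ∀ {u v} → u ~ v →
          abs (round (f u) + - round (f v)) ≈ abs (f u + - f v)
        same-contrast = edges-all⁻
          {P = λ u v → abs (round (f u) + - round (f v)) ≈ abs (f u + - f v)}
          (λ {u} {v} eq → Eq.trans (dist-comm (round (f v)) (round (f u)))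
            (Eq.trans eq (dist-comm (f u) (f v))))
          (sort-lex-squeeze (edges-all⁺ (proj₁ ∘ apart))
            (maximum (round ∘ f) round-greyscale round-compatible))

      -- Rounding is known to fix the ends of edges, and every vertex is such an end.
      wide⇒three-valued : Connected → WideGreyscale →
                          ∀ v → (f v ≈ 0#) ⊎ (f v ≈ ½) ⊎ (f v ≈ 1#)
      wide⇒three-valued conn h v with _ , v~w ← maximum⇒neighbour conn v =
        Sum.map (Eq.trans fv≈) (Sum.map (Eq.trans fv≈) (Eq.trans fv≈)) (round-image (f v))
        where
        fv≈ : f v ≈ round (f v)
        fv≈ = Eq.sym (gap⇒round-fixed (maximum-gap h) v~w)

    -- Constructing the competitor when `a` is the only agreement with `φ`.

    module _ (g-proper : ProperInitialColouring Vc g) (neighbour : ∀ v → ∃[ w ] v ~ w)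
      (φ : Vertex → Fin 2) (φ-proper : ProperColouring φ) {a : Vertex} (a∈ : a ∈ Vc)
      (ga≡φa : g a a∈ ≡ φ a) (only-a : ∀ {v} (v∈ : v ∈ Vc) → g v v∈ ≡ φ v → v ≡ a) where

      open Halved φ φ-proper a

      g-at-a : (a∈′ : a ∈ Vc) → g a a∈′ ≡ φ a
      g-at-a a∈′ = trans (cong (g a) ([]=-irrelevant a∈′ a∈)) ga≡φa

      g-elsewhere : ∀ {v} (v∈ : v ∈ Vc) → v ≢ a → g v v∈ ≡ opposite (φ v)
      g-elsewhere {v} v∈ v≢a = ≢-≢⇒≡ (v≢a ∘ only-a v∈) (opposite-≢ (φ v))

      -- At a neighbour in `Vc`, properness would force the colour other than `φ a`, which is `φ v`:
      -- a second agreement.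
      neighbour-free : ∀ {v} → v ~ a → ¬ (v ∈ Vc)
      neighbour-free {v} v~a v∈ = v≢a (only-a v∈ (≢-≢⇒≡ gv≢φa (φ-proper v~a)))
        where
        v≢a : v ≢ a
        v≢a refl = ~-irrefl a v~a

        gv≢φa : g v v∈ ≢ φ a
        gv≢φa eq = g-proper v∈ a∈ v~a (trans eq (sym ga≡φa))

      lonely⇒wide : (∀ w → φ w ≡ φ a → w ≡ a) → WideGreyscale
      lonely⇒wide lonely = record
        { colour     = value ∘ φ
        ; greyscale  = isGreyscale (0≤value ∘ φ) (value≤1 ∘ φ)
                         (φ-proper (proj₂ (neighbour a))) refl refl
        ; compatible = λ v v∈ → Eq.reflexive (cong value (sym (g≡φ v v∈)))
        ; gap        = value-gap ∘ φ-proper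
        }
        where
        g≡φ : ∀ v (v∈ : v ∈ Vc) → g v v∈ ≡ φ v
        g≡φ v v∈ with v ≟ a
        ... | yes refl = g-at-a v∈
        -- Since `v` is outside the class of `a`, its neighbour `w` is inside, hence equals `a`; but
        -- neighbours of `a` are not in `Vc`.
        ... | no  v≢a with w , v~w ← neighbour v
            with refl ← lonely w (≢-≢⇒≡ (≢-sym (φ-proper v~w)) (v≢a ∘ lonely v ∘ sym))
            = contradiction v∈ (neighbour-free v~w)

      halved-compatible : Compatible ℝ G Vc g halved
      halved-compatible v v∈ with v ≟ a
      ... | yes refl = Eq.reflexive (cong value (sym (g-at-a v∈)))
      ... | no  v≢a with v ~? a
      ...   | yes v~a = contradiction v∈ (neighbour-free v~a)
      ...   | no  _   = Eq.reflexive (cong value (sym (g-elsewhere v∈ v≢a)))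

      -- Sharing the colour of `a`, the companion `w` is not adjacent to it and so receives the
      -- opposite value; together they attain 0 and 1.
      companion⇒wide : ∀ {w} → w ≢ a → φ w ≡ φ a → WideGreyscale
      companion⇒wide {w} w≢a φw≡φa = record
        { colour     = halved
        ; greyscale  = isGreyscale {u = a} {v = w} 0≤halved halved≤1
            (≢-sym (opposite-≢ (φ a))) halved-a
            (trans (halved-far w≢a (λ w~a → φ-proper w~a φw≡φa))
                   (cong (value ∘ opposite) φw≡φa))
        ; compatible = halved-compatible
        ; gap        = halved-gap
        }

      wideGreyscale : WideGreyscale
      wideGreyscale with any? (λ w → ¬? (w ≟ a) ×-dec (φ w ≟ φ a))
      ... | yes (w , w≢a , φw≡φa) = companion⇒wide w≢a φw≡φa
      ... | no  none = lonely⇒wide λ w φw≡φa →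
        decidable-stable (w ≟ a) λ w≢a → none (w , w≢a , φw≡φa)

theorem5p6 : ∀ {c ℓ₁ ℓ₂} (ℝ : RealField c ℓ₁ ℓ₂) (G : Graph) →
    let open RealField ℝ hiding (∣_∣) in
    let open Graph G in
    Connected →
    ChromaticNumber 2 →
    (Vc : Subset order) → Nonempty Vc → Vc ⊂ ⊤ →
    (g : InitialColouring Vc) → ProperInitialColouring Vc g →
    (φ₀ φ₁ : Vertex → Fin 2) →
    ProperColouring φ₀ → ProperColouring φ₁ → ¬ (φ₀ ≗ φ₁) →
    (∣ agreement Vc g φ₀ ∣ ≡ 1) ⊎ (∣ agreement Vc g φ₁ ∣ ≡ 1) →
    (f : Vertex → Carrier) → IsMaximumContrastGreyscale ℝ G Vc g f →
    ∀ v → (f v ≈ 0#) ⊎ (f v ≈ ½) ⊎ (f v ≈ 1#)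
theorem5p6 ℝ G conn _ Vc _ _ g g-proper φ₀ φ₁ φ₀-proper φ₁-proper _ ones f f-max =
  [ single φ₀ φ₀-proper , single φ₁ φ₁-proper ]′ ones
  where
  open RealField ℝ hiding (∣_∣)
  open Graph G
  open GraphLemmas G

  -- The hypothesis treats the two colourings alike, so one argument serves whichever has the
  -- one-element agreement set.
  single : (φ : Vertex → Fin 2) → ProperColouring φ → ∣ agreement Vc g φ ∣ ≡ 1 →
           ∀ v → (f v ≈ 0#) ⊎ (f v ≈ ½) ⊎ (f v ≈ 1#)
  single φ φ-proper one
    with a , a∈A , unique ← singleton-unique one
    with a∈ , ga≡φa ← agreement⁻ Vc g φ a∈A =
    wide⇒three-valued ℝ G f-max conn $
      wideGreyscale ℝ G g-proper (maximum⇒neighbour ℝ G f-max conn) φ φ-proper a∈ ga≡φa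
        (λ v∈ eq → unique (agreement⁺ Vc g φ v∈ eq))
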